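{- Let $w$ be a positive integer. Then the class of all (finite) graphs of layered tree-width at most $w$ has asymptotic dimension at most 2.
   Context: All graphs are finite. For a graph $G$ and $x,y\in V(G)$, $d_G(x,y)$ is the minimum number of edges of a path in $G$ between $x$ and $y$. For a nonnegative integer $n$, an $n$-dimensional control function for a class $\mathcal{F}$ of graphs is a function $f:\mathbb{R}^+\to\mathbb{R}^+$ such that for every $G\in\mathcal{F}$ and every real $r>0$ there exist collections $\mathcal{U}_1,\dots,\mathcal{U}_{n+1}$ of subsets of $V(G)$ covering $V(G)$, such that for each $i$, whenever $U\neq U'$ are in $\mathcal{U}_i$ and $x\in U$, $x'\in U'$, we have $d_G(x,x')>r$, and whenever $x,x'$ lie in a common $U\in\mathcal{U}_i$ we have $d_G(x,x')\le f(r)$. The asymptotic dimension of $\mathcal{F}$ is the minimum $n$ for which there is a common $n$-dimensional control function for all graphs in $\mathcal{F}$. A layering of a graph $G$ is an ordered partition $(V_1,V_2,\dots)$ of $V(G)$ into (possibly empty) sets such that for every edge $e$ there is $i_e$ with both ends of $e$ in $V_{i_e}\cup V_{i_e+1}$. The layered tree-width of $G$ is the minimum $w$ such that there exist a tree-decomposition of $G$ and a layering of $G$ such that every bag intersects every layer in at most $w$ vertices. -}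

module Defs where

open import Data.Nat using (ℕ; zero; suc; _≤_; _∸_; _⊔_)
open import Data.Bool using (Bool; T)
open import Data.Fin using (Fin; toℕ) renaming (zero to fzero; suc to fsuc)
open import Data.Fin.Subset using (Subset; _∈_; _∩_; ∣_∣)
open import Data.Vec using (tabulate)
open import Data.Product using (Σ; ∃; ∃-syntax; _×_; _,_)
open import Data.Sum using (_⊎_)
open import Relation.Nullary using (¬_)
open import Relation.Nullary.Decidable using (⌊_⌋)
open import Relation.Binary.PropositionalEquality using (_≡_; _≢_)
import Data.Nat as N

record Graph : Set where
  field
    n       : ℕ
    adj     : Fin n → Fin n → Bool
    adj-sym : ∀ x y → T (adj x y) → T (adj y x)
    adj-irr : ∀ x → ¬ T (adj x x)

  Vertex : Set
  Vertex = Fin n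

  Edge : Vertex → Vertex → Set
  Edge x y = T (adj x y)

open Graph public

data Walk {A : Set} (R : A → A → Set) : A → A → ℕ → Set where
  []  : ∀ {x} → Walk R x x 0
  _∷_ : ∀ {x y z k} → R x y → Walk R y z k → Walk R x z (suc k)

-- d_G(x,y) ≤ k  (a shortest walk is a path, so this is the graph distance;
-- if x,y lie in different components, d_G(x,y) = ∞ and this never holds).
Dist≤ : (G : Graph) → Vertex G → Vertex G → ℕ → Set
Dist≤ G x y k = ∃[ m ] (m ≤ k × Walk (Edge G) x y m)

record CoverFamily (G : Graph) (d : ℕ) : Set where
  field
    m : Fin (suc d) → ℕ
    U : (i : Fin (suc d)) → Fin (m i) → Subset (n G)

open CoverFamily public

GoodCover : (G : Graph) (d : ℕ) → CoverFamily G d → (r D : ℕ) → Set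
GoodCover G d 𝒰 r D =
    (∀ (v : Vertex G) → ∃[ i ] ∃[ j ] (v ∈ U 𝒰 i j))
  × (∀ i j k (x x' : Vertex G) → j ≢ k → x ∈ U 𝒰 i j → x' ∈ U 𝒰 i k
       → ¬ Dist≤ G x x' r)
  × (∀ i j (x x' : Vertex G) → x ∈ U 𝒰 i j → x' ∈ U 𝒰 i j
       → Dist≤ G x x' D)

-- f is a d-dimensional control function for the class ℱ
-- (distances are integers, so scales r and bounds f(r) may be taken in ℕ)
IsControlFunction : (ℱ : Graph → Set) (d : ℕ) (f : ℕ → ℕ) → Set
IsControlFunction ℱ d f =
  ∀ (G : Graph) → ℱ G → ∀ (r : ℕ) → Σ (CoverFamily G d) λ 𝒰 → GoodCover G d 𝒰 r (f r)

AsdimAtMost : (ℱ : Graph → Set) (d : ℕ) → Set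
AsdimAtMost ℱ d = Σ (ℕ → ℕ) λ f → IsControlFunction ℱ d f

-- Trees, encoded by a parent function: nodes Fin (suc size); node (fsuc i)
-- has parent (parent i), whose index is ≤ i.  Every finite tree arises so.

record Tree : Set where
  field
    size     : ℕ
    parent   : Fin size → Fin (suc size)
    parent-≤ : ∀ i → toℕ (parent i) ≤ toℕ i

  Node : Set
  Node = Fin (suc size)

  TEdge : Node → Node → Set
  TEdge a b = (∃[ i ] (a ≡ fsuc i × b ≡ parent i)) ⊎ (∃[ i ] (b ≡ fsuc i × a ≡ parent i))

open Tree public

ConnectedIn : (T : Tree) → (Node T → Set) → Set
ConnectedIn T P =
  ∀ a b → P a → P b →
    ∃[ k ] Walk (λ x y → TEdge T x y × P x × P y) a b k

record TreeDecomposition (G : Graph) : Set where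
  field
    tree : Tree
    bag  : Node tree → Subset (n G)
    vertex-cover : ∀ (v : Vertex G) → ∃[ a ] (v ∈ bag a)
    edge-cover   : ∀ (x y : Vertex G) → Edge G x y → ∃[ a ] (x ∈ bag a × y ∈ bag a)
    connected    : ∀ (v : Vertex G) → ConnectedIn tree (λ a → v ∈ bag a)

open TreeDecomposition public

IsLayering : (G : Graph) → (Vertex G → ℕ) → Set
IsLayering G layer =
  ∀ x y → Edge G x y → ((layer x ∸ layer y) ⊔ (layer y ∸ layer x)) ≤ 1

LayerSet : (G : Graph) → (Vertex G → ℕ) → ℕ → Subset (n G)
LayerSet G layer ℓ = tabulate (λ v → ⌊ layer v N.≟ ℓ ⌋)

LayeredTreeWidthAtMost : ℕ → Graph → Set
LayeredTreeWidthAtMost w G =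
  Σ (TreeDecomposition G) λ 𝒯 →
  Σ (Vertex G → ℕ) λ layer →
    IsLayering G layer ×
    (∀ (a : Node (tree 𝒯)) (ℓ : ℕ) → ∣ bag 𝒯 a ∩ LayerSet G layer ℓ ∣ ≤ w)

module Submission where

-- Bounded tree-width gives two colours: for every r, the vertices of a graph
-- with bags of size at most k can be 2-coloured so that monochromatic chains
-- with steps of length at most r have bounded extent. Induct on k. Going down
-- the tree, a node opens a new region when its bag is far from the bag of the
-- current center. All bags of a region meet the neighbourhood N of the bag of
-- its center, so the torso of the region minus N has smaller bags and is
-- coloured by induction at a much larger scale. Chains near the center are
-- harmless, since they stay close to at most k vertices, and two layers of
-- opposite colours below the adhesion of each region keep chains from
-- descending more than one region.
--
-- For layered tree-width, cut the layering into strips of width r + 1, cyclically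
-- block A, zone, block B, zone. Colour the zones by {1, 2}, each block A by
-- {0, 1} and each block B by {0, 2}, choosing the scale of the blocks after the
-- bound for the zones. A chain of colour 0 stays in one block; a chain of
-- colour 1 stays in one block A and its two zones, hence is a chain in the block
-- up to bounded excursions, and likewise for colour 2 with block B.

open import Defs
open import Data.Bool using (Bool; true; false; if_then_else_; T?)
open import Data.Empty using (⊥-elim)
open import Data.Fin as Fin using (Fin)
import Data.Fin.Properties as Fin
import Data.Fin.Subset as Sub
import Data.Fin.Subset.Properties as Sub
open import Data.List using
  (List; []; _∷_; length; filter; map; concatMap; applyUpTo; allFin; cartesianProduct)
import Data.List.Properties as List
open import Data.List.Membership.Propositional using (_∈_; find; lose)
open import Data.List.Membership.Propositional.Properties using
  (∈-filter⁺; ∈-filter⁻; ∈-map⁺; ∈-map⁻; ∈-concatMap⁺; ∈-concatMap⁻; ∈-applyUpTo⁺; ∈-applyUpTo⁻;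
   ∈-allFin; ∈-cartesianProduct⁺)
import Data.List.Membership.DecPropositional as DecMembership
open import Data.List.Relation.Unary.Any as Any using (Any; here; there)
open import Data.Nat using (ℕ; zero; suc; _+_; _*_; _∸_; _⊔_; _≤_; _<_; z≤n; s≤s)
open import Data.Nat.DivMod using
  (_/_; _%_; m/n*n≤m; m≡m%n+[m/n]*n; m%n<n; /-monoˡ-≤; m/n≡1+[m∸n]/n)
open import Data.Nat.Properties
open import Data.Nat.Tactic.RingSolver using (solve-∀)
open import Data.Product using (Σ; ∃; ∃-syntax; _×_; _,_; proj₁; proj₂)
open import Data.Sum using (_⊎_; inj₁; inj₂; swap; [_,_]′)
open import Data.Unit using (⊤; tt)
import Data.Vec as Vec
import Data.Vec.Properties as Vec
open import Function using (_∘_; id)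
open import Relation.Binary using (DecidableEquality; tri<; tri≈; tri>)
open import Relation.Binary.Construct.Closure.Equivalence as Eq using (EqClosure; return)
open import Relation.Binary.Construct.Closure.ReflexiveTransitive using (ε; _◅_; _◅◅_)
open import Relation.Binary.Construct.Closure.Symmetric using (fwd; bwd)
open import Relation.Binary.PropositionalEquality
open import Relation.Nullary using (¬_; Dec; yes; no; does; contradiction)
open import Relation.Nullary.Decidable using
  (_×-dec_; _⊎-dec_; ¬?; map′; decidable-stable; dec-true; isYes≗does; isYes)
open import Relation.Unary using (Decidable)

-- Bounded distance and chains.

data Dist {V : Set} (E : V → V → Set) : ℕ → V → V → Set where
  stop : ∀ {m x} → Dist E m x x
  step : ∀ {m x y z} → E x y → Dist E m y z → Dist E (suc m) x z

module _ {V : Set} {E : V → V → Set} where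

  Dist-mono : ∀ {m m' x y} → m ≤ m' → Dist E m x y → Dist E m' x y
  Dist-mono _        stop       = stop
  Dist-mono (s≤s le) (step e d) = step e (Dist-mono le d)

  Dist-trans : ∀ {m m' x y z} → Dist E m x y → Dist E m' y z → Dist E (m + m') x z
  Dist-trans {m} {m'} stop d = Dist-mono (m≤n+m m' m) d
  Dist-trans (step e d) d'   = step e (Dist-trans d d')

  Dist-sym : (∀ {x y} → E x y → E y x) → ∀ {m x y} → Dist E m x y → Dist E m y x
  Dist-sym s stop = stop
  Dist-sym s (step {m} e d) =
    Dist-mono (≤-reflexive (+-comm m 1)) (Dist-trans (Dist-sym s d) (step (s e) (stop {m = 0})))

Dist-concat : ∀ {V : Set} {E E' : V → V → Set} {R} → (∀ {x y} → E' x y → Dist E R x y) →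
              ∀ {m x y} → Dist E' m x y → Dist E (m * R) x y
Dist-concat f stop       = stop
Dist-concat f (step e d) = Dist-trans (f e) (Dist-concat f d)

Dist? : ∀ {n} {E : Fin n → Fin n → Set} → (∀ x y → Dec (E x y)) → ∀ m x y → Dec (Dist E m x y)
Dist? E? zero x y = map′ (λ { refl → stop }) (λ { stop → refl }) (x Fin.≟ y)
Dist? {E = E} E? (suc m) x y =
  map′ from to ((x Fin.≟ y) ⊎-dec Fin.any? (λ z → E? x z ×-dec Dist? E? m z y))
  where
  from : x ≡ y ⊎ (∃ λ z → E x z × Dist E m z y) → Dist E (suc m) x y
  from (inj₁ refl)        = stop
  from (inj₂ (z , e , d)) = step e d
  to : Dist E (suc m) x y → x ≡ y ⊎ (∃ λ z → E x z × Dist E m z y)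
  to stop       = inj₁ refl
  to (step e d) = inj₂ (_ , e , d)

data Chain {V : Set} (M : V → Set) (S : V → V → Set) : V → V → Set where
  end  : ∀ {x} → M x → Chain M S x x
  link : ∀ {x y z} → M x → S x y → Chain M S y z → Chain M S x z

Chain-head : ∀ {V : Set} {M : V → Set} {S : V → V → Set} {x y} → Chain M S x y → M x
Chain-head (end m)      = m
Chain-head (link m _ _) = m

Chain-map : ∀ {V V' : Set} {M : V → Set} {S : V → V → Set} {M' : V' → Set} {S' : V' → V' → Set} →
            (f : V → V') → (∀ {v} → M v → M' (f v)) →
            (∀ {x y} → M x → M y → S x y → S' (f x) (f y)) →
            ∀ {x y} → Chain M S x y → Chain M' S' (f x) (f y)
Chain-map f g h (end m)      = end (g m)
Chain-map f g h (link m s c) = link (g m) (h m (Chain-head c) s) (Chain-map f g h c)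

-- Used to confine a chain by an invariant of its steps: the region, the strip or the group of
-- strips of a vertex.
Chain-const : ∀ {V C : Set} {M : V → Set} {S : V → V → Set} (f : V → C) →
              (∀ {x y} → M x → M y → S x y → f x ≡ f y) →
              ∀ {c x y} → f x ≡ c → Chain M S x y → Chain (λ v → M v × f v ≡ c) S x y
Chain-const f pres eq (end m) = end (m , eq)
Chain-const f pres eq (link m s c) =
  link (m , eq) s (Chain-const f pres (trans (sym (pres m (Chain-head c) s)) eq) c)

-- Bridging bounded excursions.

module _ {V : Set} {E : V → V → Set} (E-sym : ∀ {x y} → E x y → E y x)
         {M Q : V → Set} (Q? : Decidable Q) (r K : ℕ) where

  private
    In Out : V → Set
    In v  = M v × Q v
    Out v = M v × ¬ Q v

    Jump : V → V → Set
    Jump = Dist E (r + (K + r))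

  module _ (inside : ∀ {x y} → Chain In (Dist E r) x y → Dist E K x y) where

    private
      data Prefix (x u : V) : Set where
        none : x ≡ u → Prefix x u
        some : ∀ {w} → Chain In (Dist E r) x w → Dist E r w u → Prefix x u

      -- In `mixed`, `u` and `u'` are the first and the last vertex of the chain outside `Q`.
      data Split (x y : V) : Set where
        all-in : Chain In (Dist E r) x y → Split x y
        mixed  : ∀ {u u'} → Prefix x u → Chain Out Jump u u' → Dist E (r + K) u' y → Split x y


      Prefix-dist : ∀ {x u} → Prefix x u → Dist E (K + r) x u
      Prefix-dist (none refl) = stop
      Prefix-dist (some c d)  = Dist-trans (inside c) d

      split : ∀ {x y} → Chain M (Dist E r) x y → Split x y
      split {x} (end m) with Q? x
      ... | yes q = all-in (end (m , q))
      ... | no ¬q = mixed (none refl) (end (m , ¬q)) stop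
      split {x} (link m d c) with Q? x | split c
      ... | yes q | all-in c'             = all-in (link (m , q) d c')
      ... | yes q | mixed (none refl) j e = mixed (some (end (m , q)) d) j e
      ... | yes q | mixed (some c' d') j e = mixed (some (link (m , q) d c') d') j e
      ... | no ¬q | all-in c'   = mixed (none refl) (end (m , ¬q)) (Dist-trans d (inside c'))
      ... | no ¬q | mixed p j e =
        mixed (none refl) (link (m , ¬q) (Dist-trans d (Prefix-dist p)) j) e

    -- A run inside `Q` spans at most `K`, so consecutive vertices outside `Q` are at most a step, a
    -- run and a step apart. They form a chain at scale `r + (K + r)`; the runs before its first and
    -- after its last vertex cost `K + r` and `r + K`.
    excursion-bound : ∀ {D} → (∀ {x y} → Chain Out Jump x y → Dist E D x y) →
                      ∀ {x y} → Chain M (Dist E r) x y → Dist E ((K + r) + (D + (r + K))) x y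
    excursion-bound {D} outside c with split c
    ... | all-in c'   = Dist-mono (≤-trans (m≤m+n K r) (m≤m+n (K + r) _)) (inside c')
    ... | mixed p j e = Dist-trans (Prefix-dist p) (Dist-trans (outside j) e)

nearBound : ℕ → ℕ → ℕ → ℕ
nearBound zero    ρ q = 0
nearBound (suc k) ρ q = (nearBound k ρ q + q) + ((ρ + ρ) + (q + nearBound k ρ q))

module Metric {n : ℕ} {E : Fin n → Fin n → Set} (E? : ∀ x y → Dec (E x y))
              (E-sym : ∀ {x y} → E x y → E y x) where

  Near : ℕ → List (Fin n) → Fin n → Set
  Near m X v = Any (Dist E m v) X

  near? : ∀ m X v → Dec (Near m X v)
  near? m X v = Any.any? (Dist? E? m v) X

  -- Induct on the list. Members of `M` not near the tail are all within `ρ` of the head, so any two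
  -- of them are within `ρ + ρ`, however long the jumps between them. Runs near the tail are bounded
  -- by induction.
  near-list-bound : ∀ X {k ρ q} → length X ≤ k → ∀ {M : Fin n → Set} → (∀ {v} → M v → Near ρ X v) →
                    ∀ {x y} → Chain M (Dist E q) x y → Dist E (nearBound k ρ q) x y
  near-list-bound [] _ near c with near (Chain-head c)
  ... | ()
  near-list-bound (z ∷ X) {suc k} {ρ} {q} (s≤s le) {M} near =
    excursion-bound E-sym (near? ρ X) q _
      (near-list-bound X le proj₂)
      (λ c → Dist-trans (close (Chain-head c)) (Dist-sym E-sym (close (Chain-last c))))
    where
    close : ∀ {v} → M v × ¬ Near ρ X v → Dist E ρ v z
    close (m , ¬near) with near m
    ... | here d  = d
    ... | there a = contradiction a ¬near
    Chain-last : ∀ {M' : Fin n → Set} {S x y} → Chain M' S x y → M' y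
    Chain-last (end m)      = m
    Chain-last (link _ _ c) = Chain-last c

-- Rooted trees of bags.

data _≼_ {A : Set} (t : List A) : List A → Set where
  same  : t ≼ t
  above : ∀ {i p} → t ≼ p → t ≼ (i ∷ p)

module _ {A : Set} where

  ≼-trans : ∀ {s t u : List A} → s ≼ t → t ≼ u → s ≼ u
  ≼-trans a same      = a
  ≼-trans a (above b) = above (≼-trans a b)

  ≼-length : ∀ {s t : List A} → s ≼ t → length s ≤ length t
  ≼-length same      = ≤-refl
  ≼-length (above a) = m≤n⇒m≤1+n (≼-length a)

  ∷⋠ : ∀ {i} {p q : List A} → q ≼ p → ¬ ((i ∷ p) ≼ q)
  ∷⋠ a b = 1+n≰n (≤-trans (≼-length b) (≼-length a))

  ≼-antisym : ∀ {s t : List A} → s ≼ t → t ≼ s → s ≡ t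
  ≼-antisym same      _ = refl
  ≼-antisym (above a) b = contradiction b (∷⋠ a)

  ≼-comparable : ∀ {s t u : List A} → s ≼ u → t ≼ u → s ≼ t ⊎ t ≼ s
  ≼-comparable same      b         = inj₂ b
  ≼-comparable (above a) same      = inj₁ (above a)
  ≼-comparable (above a) (above b) = ≼-comparable a b

  ≼-dec : DecidableEquality A → ∀ s t → Dec (s ≼ t)
  ≼-dec _≟_ s []      = map′ (λ { refl → same }) (λ { same → refl }) (List.≡-dec _≟_ s [])
  ≼-dec _≟_ s (i ∷ p) = map′ from to (List.≡-dec _≟_ s (i ∷ p) ⊎-dec ≼-dec _≟_ s p)
    where
    from : s ≡ i ∷ p ⊎ s ≼ p → s ≼ (i ∷ p)
    from (inj₁ refl) = same
    from (inj₂ a)    = above a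
    to : s ≼ (i ∷ p) → s ≡ i ∷ p ⊎ s ≼ p
    to same      = inj₁ refl
    to (above a) = inj₂ a

-- A node of a rooted tree is the list of labels on its path to the root, so
-- that the parent of i ∷ p is p and s ≼ t says that s is an ancestor of t.
record RootedBags (V A : Set) : Set₁ where
  field
    bagAt   : List A → List V
    top     : V → List A
    up-root : ∀ {v} → v ∈ bagAt [] → top v ≡ []
    up      : ∀ {v i p} → v ∈ bagAt (i ∷ p) → top v ≡ i ∷ p ⊎ v ∈ bagAt p

  -- Stands for having a common bag, without naming one: of two vertices in a common bag, the first
  -- to reach its top on the way to the root has the other in that bag (`common-bag`).
  Adjoined : V → V → Set
  Adjoined x y = x ∈ bagAt (top y) ⊎ y ∈ bagAt (top x)

  Width≤ : ℕ → Set
  Width≤ k = ∀ t → length (bagAt t) ≤ k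

  top≼ : ∀ t {v} → v ∈ bagAt t → top v ≼ t
  top≼ [] v∈ with up-root v∈
  ... | eq = subst (_≼ []) (sym eq) same
  top≼ (i ∷ p) v∈ with up v∈
  ... | inj₁ eq  = subst (_≼ (i ∷ p)) (sym eq) same
  ... | inj₂ v∈p = above (top≼ p v∈p)

  -- On the way up from `s` the vertex can drop out only at its top, and a top met before `t` is
  -- reached would lie below `t`.
  climb : ∀ {s t v} → v ∈ bagAt s → t ≼ s → ¬ (t ≼ top v) → v ∈ bagAt t
  climb v∈ same ¬a = v∈
  climb v∈ (above a) ¬a with up v∈
  ... | inj₁ eq  = contradiction (subst (_ ≼_) (sym eq) (above a)) ¬a
  ... | inj₂ v∈p = climb v∈p a ¬a

  common-bag : ∀ t {x y} → x ∈ bagAt t → y ∈ bagAt t → Adjoined x y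
  common-bag [] x∈ y∈ = inj₁ (subst (λ t → _ ∈ bagAt t) (sym (up-root y∈)) x∈)
  common-bag (i ∷ p) x∈ y∈ with up x∈ | up y∈
  ... | _        | inj₁ eq  = inj₁ (subst (λ t → _ ∈ bagAt t) (sym eq) x∈)
  ... | inj₁ eq  | inj₂ _   = inj₂ (subst (λ t → _ ∈ bagAt t) (sym eq) y∈)
  ... | inj₂ x∈p | inj₂ y∈p = common-bag p x∈p y∈p

  -- The separator property of bags, for one edge: the end `x` cannot lie in the bag at `top y`, as
  -- then `t` would be above `top y`. So `y` lies in a bag below `t` and climbs to `t`.
  separate : ∀ {t x y} → Adjoined x y → t ≼ top x → ¬ (t ≼ top y) → y ∈ bagAt t
  separate (inj₁ x∈) a ¬b = contradiction (≼-trans a (top≼ _ x∈)) ¬b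
  separate (inj₂ y∈) a ¬b = climb y∈ a ¬b

record BagGraph (n : ℕ) (A : Set) : Set₁ where
  field
    E      : Fin n → Fin n → Set
    E?     : ∀ x y → Dec (E x y)
    E-sym  : ∀ {x y} → E x y → E y x
    bags   : RootedBags (Fin n) A
    E-bags : ∀ {x y} → E x y → RootedBags.Adjoined bags x y

  open RootedBags bags public
  open Metric E? E-sym public

  -- Take for `z` the first vertex of the walk whose top is outside the subtree of `t`.
  separate-dist : ∀ {t m x y} → Dist E m x y → t ≼ top x → ¬ (t ≼ top y) →
                  ((u v : List A) → Dec (u ≼ v)) →
                  ∃ λ z → z ∈ bagAt t × ¬ (t ≼ top z) × Dist E m x z × Dist E m z y
  separate-dist stop a ¬b _ = contradiction a ¬b
  separate-dist {t} (step {y = z} e d) a ¬b dec with dec t (top z)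
  ... | no ¬c = z , separate (E-bags e) a ¬c , ¬c , step e stop , Dist-mono (n≤1+n _) d
  ... | yes c with separate-dist d c ¬b dec
  ...   | w , w∈ , ¬w , d₁ , d₂ = w , w∈ , ¬w , step e d₁ , Dist-mono (n≤1+n _) d₂

-- Centers, regions and their adhesions.

module Centers {n : ℕ} {A : Set} (_≟A_ : DecidableEquality A) (G : BagGraph n A) (ρ : ℕ) where
  open BagGraph G

  _≟L_ : DecidableEquality (List A)
  _≟L_ = List.≡-dec _≟A_

  _≼?_ : ∀ s t → Dec (s ≼ t)
  _≼?_ = ≼-dec _≟A_

  Meets : List A → List A → Set
  Meets t s = Any (Near ρ (bagAt s)) (bagAt t)

  meets? : ∀ t s → Dec (Meets t s)
  meets? t s = Any.any? (near? ρ (bagAt s)) (bagAt t)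

  center : List A → List A
  center [] = []
  center (i ∷ p) = if does (meets? (i ∷ p) (center p)) then center p else i ∷ p

  center-cases : ∀ i p → (center (i ∷ p) ≡ center p × Meets (i ∷ p) (center p))
                       ⊎ (center (i ∷ p) ≡ i ∷ p × ¬ Meets (i ∷ p) (center p))
  center-cases i p with meets? (i ∷ p) (center p)
  ... | yes m = inj₁ (refl , m)
  ... | no ¬m = inj₂ (refl , ¬m)

  center≼ : ∀ t → center t ≼ t
  center≼ [] = same
  center≼ (i ∷ p) with center-cases i p
  ... | inj₁ (eq , _) = subst (_≼ (i ∷ p)) (sym eq) (above (center≼ p))
  ... | inj₂ (eq , _) = subst (_≼ (i ∷ p)) (sym eq) same

  -- Regions are connected in the tree: on the way up from `t`, the first node that is its own
  -- center is `center t`.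
  center-interval : ∀ {q t} → center t ≼ q → q ≼ t → center q ≡ center t
  center-interval a same = refl
  center-interval a (above {i} {p} b) with center-cases i p
  ... | inj₁ (eq , _) = trans (center-interval (subst (_≼ _) eq a) b) (sym eq)
  ... | inj₂ (eq , _) = contradiction (subst (_≼ _) eq a) (∷⋠ b)

  center-idem : ∀ t → center (center t) ≡ center t
  center-idem t = center-interval same (center≼ t)

  -- A node that opens a region is its own center, and meets it because its bag is nonempty.
  center-meets : ∀ t {v} → v ∈ bagAt t → Meets t (center t)
  center-meets [] v∈ = lose v∈ (lose v∈ stop)
  center-meets (i ∷ p) v∈ with center-cases i p
  ... | inj₁ (eq , m) = subst (Meets (i ∷ p)) (sym eq) m
  ... | inj₂ (eq , _) = subst (Meets (i ∷ p)) (sym eq) (lose v∈ (lose v∈ stop))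

  reg : Fin n → List A
  reg v = center (top v)

  reg≼ : ∀ v → reg v ≼ top v
  reg≼ v = center≼ (top v)

  NearBag : ℕ → Fin n → Set
  NearBag m v = Near m (bagAt (reg v)) v

  nearBag? : ∀ m v → Dec (NearBag m v)
  nearBag? m v = near? m (bagAt (reg v)) v

  -- The vertices of the center's bag whose top is outside the center's subtree form the adhesion of
  -- the region to its parent region.
  NearAdh : ℕ → Fin n → Set
  NearAdh m v = Any (λ z → ¬ (reg v ≼ top z) × Dist E m v z) (bagAt (reg v))

  nearAdh? : ∀ m v → Dec (NearAdh m v)
  nearAdh? m v = Any.any? (λ z → ¬? (reg v ≼? top z) ×-dec Dist? E? m v z) (bagAt (reg v))

  NearAdh⇒NearBag : ∀ {m m' v} → m ≤ m' → NearAdh m v → NearBag m' v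
  NearAdh⇒NearBag le = Any.map (λ (_ , d) → Dist-mono le d)

  record AdhesionVertex (s : List A) (z : Fin n) : Set where
    field
      {label} : A
      {par}   : List A
      s≡      : s ≡ label ∷ par
      z∈par   : z ∈ bagAt par
      reg≡    : reg z ≡ center par
      far     : ¬ NearBag ρ z

  -- The node `s` opened a region, so its bag is further than `ρ` from the bag of `center par`.
  -- Since `z` lies in the bags of both `s` and `par`, it is not in the bag of `center par`; its top
  -- is therefore below that center, which puts `z` in the parent region.
  adhesion : ∀ {s z} → center s ≡ s → z ∈ bagAt s → ¬ (s ≼ top z) → AdhesionVertex s z
  adhesion {[]} cs z∈ ¬a = contradiction (subst ([] ≼_) (sym (up-root z∈)) same) ¬a
  adhesion {i ∷ p} {z} cs z∈ ¬a with center-cases i p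
  ... | inj₁ (eq , _) = contradiction (subst (_≼ p) (trans (sym eq) cs) (center≼ p)) (∷⋠ same)
  ... | inj₂ (_ , ¬m) with up z∈
  ...   | inj₁ eq  = contradiction (subst ((i ∷ p) ≼_) (sym eq) same) ¬a
  ...   | inj₂ z∈p = record { s≡ = refl ; z∈par = z∈p ; reg≡ = regz ; far = far }
    where
    below : center p ≼ top z
    below = decidable-stable (center p ≼? top z)
              (λ ¬b → ¬m (lose z∈ (lose (climb z∈p (center≼ p) ¬b) stop)))
    regz : reg z ≡ center p
    regz = center-interval below (top≼ p z∈p)
    far : ¬ NearBag ρ z
    far near = ¬m (lose z∈ (subst (λ s → Near ρ (bagAt s) z) regz near))

  -- Otherwise both centers are ancestors of one top, hence comparable, and the lower one lies
  -- between the other center and a top of that center's region; `center-interval` makes them equal.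
  reg-split : ∀ {x y} → reg x ≢ reg y → ¬ (reg x ≼ top y) ⊎ ¬ (reg y ≼ top x)
  reg-split {x} {y} ne with reg x ≼? top y | reg y ≼? top x
  ... | no ¬a | _     = inj₁ ¬a
  ... | yes _ | no ¬b = inj₂ ¬b
  ... | yes a | yes b with ≼-comparable (reg≼ x) b
  ...   | inj₁ x≼y = contradiction (trans (sym (center-interval x≼y b)) (center-idem (top y))) ne
  ...   | inj₂ y≼x =
    contradiction (trans (sym (center-idem (top x))) (center-interval y≼x a)) ne

  -- By `reg-split` the walk leaves the subtree of one of the two centers, and it does so through
  -- the adhesion there.
  crossing : ∀ {m x y} → reg x ≢ reg y → Dist E m x y → NearAdh m x ⊎ NearAdh m y
  crossing {m} {x} {y} ne d with reg-split ne
  ... | inj₁ ¬a with separate-dist d (reg≼ x) ¬a _≼?_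
  ...   | z , z∈ , ¬z , d₁ , _ = inj₁ (lose z∈ (¬z , d₁))
  crossing {m} {x} {y} ne d | inj₂ ¬b with separate-dist (Dist-sym E-sym d) (reg≼ y) ¬b _≼?_
  ...   | z , z∈ , ¬z , d₁ , _ = inj₂ (lose z∈ (¬z , d₁))

-- Torsos of the regions.

module Torso {n : ℕ} {A : Set} (_≟A_ : DecidableEquality A) (G : BagGraph n A) (ρ R : ℕ) where
  open BagGraph G
  open Centers _≟A_ G ρ

  Kept : List A → Fin n → Set
  Kept t v = reg v ≡ center t × ¬ NearBag ρ v

  kept? : ∀ t v → Dec (Kept t v)
  kept? t v = (reg v ≟L center t) ×-dec ¬? (nearBag? ρ v)

  torsoBag : List A → List (Fin n)
  torsoBag t = filter (kept? t) (bagAt t)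

  torsoBags : RootedBags (Fin n) A
  torsoBags = record
    { bagAt   = torsoBag
    ; top     = top
    ; up-root = λ v∈ → up-root (proj₁ (∈-filter⁻ (kept? []) v∈))
    ; up      = torso-up
    }
    where
    torso-up : ∀ {v i p} → v ∈ torsoBag (i ∷ p) → top v ≡ i ∷ p ⊎ v ∈ torsoBag p
    torso-up {v} {i} {p} v∈' with ∈-filter⁻ (kept? (i ∷ p)) {xs = bagAt (i ∷ p)} v∈'
    ... | v∈ , regv , ¬near with center-cases i p | up v∈
    ...   | _             | inj₁ eq  = inj₁ eq
    ...   | inj₁ (eq , _) | inj₂ v∈p = inj₂ (∈-filter⁺ (kept? p) v∈p (trans regv eq , ¬near))
    -- Here `i ∷ p` opened a region, so it is the center of the kept vertex `v`, and `top v` lies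
    -- both below and above it.
    ...   | inj₂ (eq , _) | inj₂ v∈p =
      inj₁ (≼-antisym (top≼ (i ∷ p) v∈) (subst (_≼ top v) (trans regv eq) (reg≼ v)))

  -- One graph serves all regions, since its edges stay within a region. The distance condition
  -- bounds the stretch: a torso walk expands to a walk of `E` at most `R` times as long.
  torso : BagGraph n A
  torso = record
    { E      = λ x y → Adjoined' x y × Dist E R x y
    ; E?     = λ x y → ((x ∈? torsoBag (top y)) ⊎-dec (y ∈? torsoBag (top x))) ×-dec Dist? E? R x y
    ; E-sym  = λ (a , d) → swap a , Dist-sym E-sym d
    ; bags   = torsoBags
    ; E-bags = proj₁
    }
    where
    open RootedBags torsoBags using () renaming (Adjoined to Adjoined')
    open DecMembership Fin._≟_ using (_∈?_)

  open BagGraph torso public using () renaming (E to E'; Width≤ to Width≤')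

  torso-edge : ∀ {t x y} → x ∈ bagAt t → y ∈ bagAt t → Kept t x → Kept t y → Dist E R x y → E' x y
  torso-edge {t} x∈ y∈ kx ky d =
    RootedBags.common-bag torsoBags t (∈-filter⁺ (kept? t) x∈ kx) (∈-filter⁺ (kept? t) y∈ ky) , d

  -- Every nonempty bag t contains a vertex near the bag of its center, and the torso drops it.
  torso-width : ∀ {k} → Width≤ (suc k) → Width≤' k
  torso-width {k} w t = go (bagAt t) (λ v∈ → center-meets t v∈) (w t)
    where
    dropped : ∀ {v} → Near ρ (bagAt (center t)) v → ¬ Kept t v
    dropped {v} near (regv , ¬near) = ¬near (subst (λ s → Near ρ (bagAt s) v) (sym regv) near)
    go : ∀ xs → (∀ {v} → v ∈ xs → Any (Near ρ (bagAt (center t))) xs) → length xs ≤ suc k →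
         length (filter (kept? t) xs) ≤ k
    go []       _     _  = z≤n
    go (x ∷ xs) meets le =
      ≤-pred (≤-trans (List.filter-notAll (kept? t) (x ∷ xs)
                         (Any.map dropped (meets (here refl)))) le)

  module _ {s : List A} where

    private
      Close : ℕ → Fin n → Set
      Close m = Near m (bagAt s)

      Close-step : ∀ {m x z} → E x z → Close m z → Close (suc m) x
      Close-step e = Any.map (step e)

      Close-mono : ∀ {m m' x} → m ≤ m' → Close m x → Close m' x
      Close-mono le = Any.map (Dist-mono le)

      -- The remaining length `m` and the required distance `m + ρ` shrink together along a walk, so
      -- all its vertices stay beyond `ρ` from the bag of `s`.
      keep : ∀ m t {v} → ¬ Close (m + ρ) v → reg v ≡ s → center t ≡ s → Kept t v
      keep m t ¬c refl eq = sym eq , λ near → ¬c (Close-mono (m≤n+m ρ m) near)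

    mutual
      -- A walk in region s that avoids the neighbourhood of the bag of s
      -- leaves the region only into child regions; each excursion starts and
      -- ends in the adhesion of the child and is replaced by one torso edge.
      torso-dist : ∀ {m x y} → reg x ≡ s → reg y ≡ s → m ≤ R → ¬ Close (m + ρ) x →
                   Dist E m x y → Dist E' m x y
      torso-dist rx ry le ¬c stop = stop
      torso-dist {suc m} {x} rx ry le ¬c (step {y = z} e d) with reg z ≟L s
      ... | yes rz = step edge (torso-dist rz ry (≤-trans (n≤1+n m) le) ¬c' d)
        where
        ¬c' : ¬ Close (m + ρ) z
        ¬c' = ¬c ∘ Close-step e
        d₁ : Dist E R x z
        d₁ = Dist-mono (≤-trans (s≤s z≤n) le) (step e (stop {m = 0}))
        edge : E' x z
        edge with E-bags e
        ... | inj₁ x∈ = inj₁ (∈-filter⁺ (kept? (top z)) x∈ (keep (suc m) (top z) ¬c rx rz)) , d₁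
        ... | inj₂ z∈ = inj₂ (∈-filter⁺ (kept? (top x)) z∈ (keep m (top x) ¬c' rz rx)) , d₁
      ... | no nz with reg-split {x} {z} (λ eq → nz (trans (sym eq) rx))
      -- Leaving the subtree of `s` upwards passes through the bag of `s`, which the walk avoids.
      ...   | inj₁ ¬a = ⊥-elim (¬c (Close-step e (lose z∈s stop)))
        where
        z∈s : z ∈ bagAt s
        z∈s = separate (E-bags e) (subst (_≼ top x) rx (reg≼ x)) (subst (λ t → ¬ (t ≼ top z)) rx ¬a)
      ...   | inj₂ ¬b with adhesion (center-idem (top z)) x∈ ¬b
        where
        x∈ : x ∈ bagAt (reg z)
        x∈ = separate (swap (E-bags e)) (reg≼ z) ¬b
      ...     | record { par = p ; s≡ = z≡ ; z∈par = x∈p ; reg≡ = regx } =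
        Dist-mono (n≤1+n m)
          (torso-dist-child (center-idem (top z)) z≡ cp x∈p (keep (suc m) p ¬c rx cp) (reg≼ z)
            (step e (stop {m = 0})) le (¬c ∘ Close-step e) ry d)
        where
        cp : center p ≡ s
        cp = trans (sym regx) rx

      -- The walk entered the subtree of `u` from the adhesion vertex `a`, and `j` counts the steps
      -- since. It leaves through another vertex of the adhesion; both lie in the bag of the parent
      -- `p`, and `j + m ≤ R` makes them close enough for a torso edge.
      torso-dist-child : ∀ {u i p a z y j m} → center u ≡ u → u ≡ i ∷ p → center p ≡ s →
                         a ∈ bagAt p → Kept p a → u ≼ top z → Dist E j a z → j + m ≤ R →
                         ¬ Close (m + ρ) z → reg y ≡ s → Dist E m z y → Dist E' m a y
      -- The walk cannot end here: a vertex of region `s` below `u` would force `center u` to be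
      -- `s`, a proper ancestor of `u`.
      torso-dist-child {p = p} {z = z} cu refl cp a∈ ka below da le ¬c ry stop =
        contradiction (subst (_≼ p) (trans cp (sym eq)) (center≼ p)) (∷⋠ same)
        where
        s≼u : s ≼ _
        s≼u = above (subst (_≼ p) cp (center≼ p))
        eq : _ ∷ p ≡ s
        eq = trans (sym cu) (trans (center-interval (subst (_≼ _) (sym ry) s≼u) below) ry)
      torso-dist-child {u} {p = p} {a} {j = j} {suc m} cu refl cp a∈ ka below da le ¬c ry
                       (step {y = z} e d)
        with u ≼? top z
      ... | yes below' =
        Dist-mono (n≤1+n m)
          (torso-dist-child cu refl cp a∈ ka below'
            (Dist-trans da (step e (stop {m = 0}))) (≤-trans (≤-reflexive (+-assoc j 1 m)) le)
            (¬c ∘ Close-step e) ry d)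
      ... | no ¬b with adhesion cu (separate (E-bags e) below ¬b) ¬b
      ...   | record { s≡ = refl ; z∈par = z∈ ; reg≡ = regz } =
        step (torso-edge a∈ z∈ ka (keep m p ¬c' (trans regz cp) cp)
               (Dist-mono (≤-trans (+-monoʳ-≤ j (s≤s z≤n)) le)
                          (Dist-trans da (step e (stop {m = 0})))))
             (torso-dist (trans regz cp) ry m≤R ¬c' d)
        where
        m≤R : m ≤ R
        m≤R = ≤-trans (n≤1+n m) (≤-trans (m≤n+m (suc m) j) le)
        ¬c' : ¬ Close (m + ρ) z
        ¬c' = ¬c ∘ Close-step e

-- Bounds for tree-width.

separation : ℕ → ℕ
separation r = (r + r) + (r + (r + r))

-- The scales are chosen in this order: chains in the middle layer have extent `middleBound`; a jump
-- across one, with a projection of length `r + r` at each end, is a step at `torsoScale`; torso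
-- chains at that scale have bounded extent by induction on `k`, and are multiplied by the scale on
-- return to the graph.
middleBound torsoScale torsoStretch farBound : ℕ → ℕ → ℕ
middleBound k r = nearBound (suc k) (r + r) r
torsoScale k r = (r + r) + ((r + (middleBound k r + r)) + (r + r))

twBound : ℕ → ℕ → ℕ
torsoStretch k r = (r + r) + (twBound k (torsoScale k r) * torsoScale k r + (r + r))
farBound k r = (middleBound k r + r) + (torsoStretch k r + (r + middleBound k r))
twBound zero    r = 0
twBound (suc k) r = (farBound k r + r)
  + (nearBound (suc k) ((r + r) + (torsoScale k r + separation r)) (r + (farBound k r + r))
    + (r + farBound k r))

-- Colouring a graph from a colouring of its torso.

module Colouring {n : ℕ} {A : Set} (_≟A_ : DecidableEquality A) (G : BagGraph n A) (r : ℕ)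
                 (colT : Fin n → Bool) where
  open BagGraph G

  -- This is a step of length `r` with a projection of length `r + r` at each end (`project-step`).
  ρ : ℕ
  ρ = separation r

  open Centers _≟A_ G ρ

  -- Inner vertices take the torso colour of their projection to the adhesion;
  -- the middle layer (true) followed by the nearest outer vertices (false)
  -- stops every monochromatic chain, whatever its colour, from entering the
  -- region through the adhesion and reaching its torso part.
  data Zone (v : Fin n) : Set where
    inner  : ∀ π → π ∈ bagAt (reg v) → ¬ (reg v ≼ top π) → Dist E r v π → Zone v
    middle : ∀ π → π ∈ bagAt (reg v) → ¬ (reg v ≼ top π) → Dist E (r + r) v π →
             ¬ NearAdh r v → Zone v
    outer  : ¬ NearAdh (r + r) v → Zone v

  zone : ∀ v → Zone v
  zone v with nearAdh? r v | nearAdh? (r + r) v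
  ... | yes a | _ with find a
  ...   | π , π∈ , ¬π , d = inner π π∈ ¬π d
  zone v | no ¬a | yes b with find b
  ...   | π , π∈ , ¬π , d = middle π π∈ ¬π d ¬a
  zone v | no _  | no ¬b = outer ¬b

  projectᶻ : ∀ {v} → Zone v → Fin n
  projectᶻ (inner π _ _ _)    = π
  projectᶻ (middle π _ _ _ _) = π
  projectᶻ {v} (outer _)      = v

  colourᶻ : ∀ {v} → Zone v → Bool
  colourᶻ (inner π _ _ _)    = colT π
  colourᶻ (middle _ _ _ _ _) = true
  colourᶻ {v} (outer _)      = if does (nearBag? ρ v) then false else colT v

  project : Fin n → Fin n
  project v = projectᶻ (zone v)

  colour : Fin n → Bool
  colour v = colourᶻ (zone v)

  data Middle {v : Fin n} : Zone v → Set where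
    middle : ∀ {π π∈ ¬π d ¬a} → Middle (middle π π∈ ¬π d ¬a)

  middle? : ∀ {v} (z : Zone v) → Dec (Middle z)
  middle? (inner _ _ _ _)    = no λ ()
  middle? (middle _ _ _ _ _) = yes middle
  middle? (outer _)          = no λ ()

  project-near : ∀ {v} (z : Zone v) → Dist E (r + r) v (projectᶻ z)
  project-near (inner _ _ _ d)    = Dist-mono (m≤m+n r r) d
  project-near (middle _ _ _ d _) = d
  project-near (outer _)          = stop

  -- The vertex `π` belongs to the parent region and is beyond `ρ` from the bag of its center, which
  -- contains the adhesion of that region.
  adhesion-far : ∀ {v π} → π ∈ bagAt (reg v) → ¬ (reg v ≼ top π) →
                 ∀ {m} → m ≤ ρ → ¬ NearAdh m π
  adhesion-far {v} π∈ ¬π le near =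
    AdhesionVertex.far (adhesion (center-idem (top v)) π∈ ¬π) (NearAdh⇒NearBag le near)

  outer-near-false : ∀ {v m} (¬b : ¬ NearAdh (r + r) v) → m ≤ ρ → NearAdh m v →
                     colourᶻ (outer ¬b) ≡ false
  outer-near-false {v} ¬b le near with nearBag? ρ v
  ... | yes _ = refl
  ... | no ¬n = contradiction (NearAdh⇒NearBag le near) ¬n

  2r≤ρ : r + r ≤ ρ
  2r≤ρ = m≤m+n (r + r) _

  3r≤ρ : (r + r) + r ≤ ρ
  3r≤ρ = +-monoʳ-≤ (r + r) (m≤m+n r _)

  far-far : ∀ {m x y} → ¬ NearAdh m x → ¬ NearAdh m y → Dist E m x y → reg x ≡ reg y
  far-far {x = x} {y} ¬x ¬y d with reg x ≟L reg y
  ... | yes eq = eq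
  ... | no ne  = ⊥-elim ([ ¬x , ¬y ]′ (crossing ne d))

  inner-outer : ∀ {x y π} → π ∈ bagAt (reg x) → ¬ (reg x ≼ top π) → Dist E r x π →
                ¬ NearAdh (r + r) y → Dist E r x y → reg π ≡ reg y
  inner-outer {x} π∈ ¬π dπ ¬y d =
    far-far (adhesion-far {x} π∈ ¬π 2r≤ρ) ¬y (Dist-trans (Dist-sym E-sym dπ) d)

  -- The two opposite layers act here. If `y` were in another region than `π`, then, `π` being far
  -- from its own adhesion, `y` would be near the adhesion of its region. An outer vertex there is
  -- coloured `false`, a middle one `true`.
  middle-outer : ∀ {x y π} → π ∈ bagAt (reg x) → ¬ (reg x ≼ top π) → Dist E (r + r) x π →
                 (¬y : ¬ NearAdh (r + r) y) → true ≡ colourᶻ (outer ¬y) → Dist E r x y →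
                 reg π ≡ reg y
  middle-outer {x} {y} {π} π∈ ¬π dπ ¬y same-colour d with reg π ≟L reg y
  ... | yes eq = eq
  ... | no ne with crossing ne (Dist-trans (Dist-sym E-sym dπ) d)
  ...   | inj₁ near = contradiction near (adhesion-far {x} π∈ ¬π 3r≤ρ)
  ...   | inj₂ near with trans same-colour (outer-near-false ¬y 3r≤ρ near)
  ...     | ()

  private
    farᶻ : ∀ {v} (z : Zone v) → (∃ λ ¬b → z ≡ outer ¬b) ⊎ ¬ NearAdh ρ (projectᶻ z)
    farᶻ {v} (inner _ π∈ ¬π _)    = inj₂ (adhesion-far {v} π∈ ¬π ≤-refl)
    farᶻ {v} (middle _ π∈ ¬π _ _) = inj₂ (adhesion-far {v} π∈ ¬π ≤-refl)
    farᶻ (outer ¬b)               = inj₁ (¬b , refl)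

    project-step : ∀ {x y} (zx : Zone x) (zy : Zone y) → Dist E r x y →
                   Dist E ρ (projectᶻ zx) (projectᶻ zy)
    project-step zx zy d =
      Dist-trans (Dist-sym E-sym (project-near zx)) (Dist-trans d (project-near zy))

    against-outer : ∀ {x y} (zx : Zone x) (¬y : ¬ NearAdh (r + r) y) →
                    colourᶻ zx ≡ colourᶻ (outer ¬y) → Dist E r x y → reg (projectᶻ zx) ≡ reg y
    against-outer (inner π π∈ ¬π dπ) ¬y eq d = inner-outer π∈ ¬π dπ ¬y d
    against-outer (middle π π∈ ¬π dπ _) ¬y eq d = middle-outer π∈ ¬π dπ ¬y eq d
    against-outer (outer ¬x) ¬y eq d = far-far ¬x ¬y (Dist-mono (m≤m+n r r) d)

  -- Makes the region of the projection an invariant of monochromatic chains. Projections of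
  -- vertices that are not outer are far from their adhesions and within `ρ` of each other; an outer
  -- end falls under `against-outer`.
  same-regionᶻ : ∀ {x y} (zx : Zone x) (zy : Zone y) → colourᶻ zx ≡ colourᶻ zy → Dist E r x y →
                 reg (projectᶻ zx) ≡ reg (projectᶻ zy)
  same-regionᶻ zx zy eq d with farᶻ zx | farᶻ zy
  ... | _                | inj₁ (¬y , refl) = against-outer zx ¬y eq d
  ... | inj₁ (¬x , refl) | inj₂ _ = sym (against-outer zy ¬x (sym eq) (Dist-sym E-sym d))
  ... | inj₂ fx          | inj₂ fy = far-far fx fy (project-step zx zy d)

  middle-region : ∀ {x y} {zx : Zone x} {zy : Zone y} → Middle zx → Middle zy → Dist E r x y →
                  reg x ≡ reg y
  middle-region (middle {¬a = ¬x}) (middle {¬a = ¬y}) d = far-far ¬x ¬y d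

  middle-near : ∀ {v} {z : Zone v} → Middle z → NearBag (r + r) v
  middle-near (middle {π∈ = π∈} {d = d}) = lose π∈ d

  colour-project : ∀ {v} (z : Zone v) → ¬ Middle z → ¬ NearBag ρ (projectᶻ z) →
                   colT (projectᶻ z) ≡ colourᶻ z
  colour-project (inner _ _ _ _) _ _ = refl
  colour-project (middle _ _ _ _ _) ¬m _ = contradiction middle ¬m
  colour-project {v} (outer _) _ ¬near with nearBag? ρ v
  ... | yes near = contradiction near ¬near
  ... | no _     = refl

  module _ {k : ℕ} (width : Width≤ (suc k)) where
    private
      R : ℕ
      R = torsoScale k r

    open Torso _≟A_ G ρ R

    module _ (colT-bound : ∀ {b x y} → Chain (λ v → colT v ≡ b) (Dist E' R) x y →
                           Dist E' (twBound k R) x y)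
             {b : Bool} {s : List A} where
      private
        M Far MFar : Fin n → Set
        M v    = colour v ≡ b × reg (project v) ≡ s
        -- The radius `R + ρ` is what `torso-dist` asks for on walks of length `R`.
        Far v  = ¬ Near (R + ρ) (bagAt s) (project v)
        MFar v = M v × Far v

        middle-bound : ∀ {x y} → Chain (λ v → MFar v × Middle (zone v)) (Dist E r) x y →
                       Dist E (middleBound k r) x y
        middle-bound {x} c =
          near-list-bound (bagAt (reg x)) (width (reg x))
            (λ { {v} ((_ , mid) , eq) →
                 subst (λ t → Near (r + r) (bagAt t) v) eq (middle-near mid) })
            (Chain-const reg (λ (_ , m) (_ , m') d → middle-region m m' d) refl c)

        TorsoPart : Fin n → Set
        TorsoPart v = colT v ≡ b × reg v ≡ s × ¬ Near (R + ρ) (bagAt s) v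

        torso-part : ∀ {v} → MFar v × ¬ Middle (zone v) → TorsoPart (project v)
        torso-part {v} (((refl , refl) , far) , ¬mid) =
          colour-project (zone v) ¬mid (far ∘ Any.map (Dist-mono (m≤n+m ρ R))) , refl , far

        -- The steps already jump over the middle runs. Projecting both ends adds `r + r` twice and
        -- gives exactly `R`, so the projected chain is monochromatic for `colT` in the torso.
        stretch-bound : ∀ {x y} →
                        Chain (λ v → MFar v × ¬ Middle (zone v))
                              (Dist E (r + (middleBound k r + r))) x y →
                        Dist E (torsoStretch k r) x y
        stretch-bound {x} {y} c =
          Dist-trans (project-near (zone x))
            (Dist-trans (Dist-concat proj₂ (colT-bound c'))
              (Dist-sym E-sym (project-near (zone y))))
          where
          projected : Chain TorsoPart (Dist E R) (project x) (project y)
          projected = Chain-map project torso-part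
            (λ {u} {v} _ _ d → Dist-trans (Dist-sym E-sym (project-near (zone u)))
                                 (Dist-trans d (project-near (zone v)))) c
          c' : Chain (λ v → colT v ≡ b) (Dist E' R) (project x) (project y)
          c' = Chain-map id proj₁
            (λ (_ , ru , fu) (_ , rv , _) d → torso-dist ru rv ≤-refl fu d) projected

        far-bound : ∀ {x y} → Chain MFar (Dist E r) x y → Dist E (farBound k r) x y
        far-bound = excursion-bound E-sym (λ v → middle? (zone v)) r _ middle-bound stretch-bound

      region-bound : ∀ {x y} → Chain M (Dist E r) x y → Dist E (twBound (suc k) r) x y
      region-bound =
        -- The far runs are the excursions; what remains is close to one bag, hence to at most
        -- `suc k` vertices.
        excursion-bound E-sym (λ v → ¬? (near? (R + ρ) (bagAt s) (project v))) r _ far-bound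
          (near-list-bound (bagAt s) (width s)
            (λ { {v} (_ , ¬far) →
                 Any.map (Dist-trans (project-near (zone v)))
                   (decidable-stable (near? (R + ρ) (bagAt s) (project v)) ¬far) }))

    colour-bound : (∀ {b x y} → Chain (λ v → colT v ≡ b) (Dist E' R) x y →
                                Dist E' (twBound k R) x y) →
                   ∀ {b x y} → Chain (λ v → colour v ≡ b) (Dist E r) x y →
                   Dist E (twBound (suc k) r) x y
    colour-bound colT-bound c =
      region-bound colT-bound
        (Chain-const (reg ∘ project)
          (λ {x} {y} mx my d → same-regionᶻ (zone x) (zone y) (trans mx (sym my)) d) refl c)

-- Induction on the width over all graphs and scales, since the torso is a new graph and is coloured
-- at scale `torsoScale k r`. At width 0 an edge would put a vertex into an empty bag.
bounded-treewidth-colouring :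
  ∀ k r {n A} → DecidableEquality A → (G : BagGraph n A) → BagGraph.Width≤ G k →
  Σ (Fin n → Bool) λ col → ∀ {b x y} →
    Chain (λ v → col v ≡ b) (Dist (BagGraph.E G) r) x y → Dist (BagGraph.E G) (twBound k r) x y
bounded-treewidth-colouring zero r _≟A_ G width = (λ _ → true) , λ c → edgeless c
  where
  open BagGraph G
  nonempty : ∀ {x} {xs : List (Fin _)} → x ∈ xs → ¬ (length xs ≤ 0)
  nonempty (here _)  ()
  nonempty (there _) ()
  no-edge : ∀ {x y} → ¬ E x y
  no-edge e with E-bags e
  ... | inj₁ x∈ = nonempty x∈ (width _)
  ... | inj₂ y∈ = nonempty y∈ (width _)
  edgeless : ∀ {M : _ → Set} {x y} → Chain M (Dist E r) x y → Dist E 0 x y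
  edgeless (end _) = stop
  edgeless (link _ stop c) = edgeless c
  edgeless (link _ (step e _) c) = ⊥-elim (no-edge e)
bounded-treewidth-colouring (suc k) r _≟A_ G width
  with bounded-treewidth-colouring k (torsoScale k r) _≟A_
         (Torso.torso _≟A_ G (separation r) (torsoScale k r))
         (Torso.torso-width _≟A_ G (separation r) (torsoScale k r) width)
... | colT , colT-bound =
  Colouring.colour _≟A_ G r colT , Colouring.colour-bound _≟A_ G r colT width colT-bound

-- From tree-decompositions to rooted bags.

module TreeNodes {G : Graph} (𝒯 : TreeDecomposition G) where

  private
    t : Tree
    t = tree 𝒯

    Label : Set
    Label = Fin (size t)

  tip : List Label → Node t
  tip []      = Fin.zero
  tip (i ∷ _) = Fin.suc i

  IsPath : List Label → Set
  IsPath []      = ⊤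
  IsPath (i ∷ p) = tip p ≡ parent t i × IsPath p

  isPath? : ∀ p → Dec (IsPath p)
  isPath? []      = yes tt
  isPath? (i ∷ p) = (tip p Fin.≟ parent t i) ×-dec isPath? p

  path-unique : ∀ p q → IsPath p → IsPath q → tip p ≡ tip q → p ≡ q
  path-unique [] [] _ _ _ = refl
  path-unique (i ∷ p) (.i ∷ q) (a , vp) (b , vq) refl =
    cong (i ∷_) (path-unique p q vp vq (trans a (sym b)))

  pathTo : ∀ m (a : Node t) → Fin.toℕ a ≤ m → ∃ λ p → IsPath p × tip p ≡ a
  pathTo m Fin.zero _ = [] , tt , refl
  pathTo (suc m) (Fin.suc i) (s≤s le) with pathTo m (parent t i) (≤-trans (parent-≤ t i) le)
  ... | p , vp , eq = i ∷ p , (eq , vp) , refl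

  -- Parents have smaller indices, so the node of least index whose bag contains `v` is the top of
  -- the subtree of `v`. The bound `m` drives the descent.
  first-bag : ∀ v m a → Fin.toℕ a ≤ m → v Sub.∈ bag 𝒯 a →
              ∃ λ b → v Sub.∈ bag 𝒯 b × (∀ c → v Sub.∈ bag 𝒯 c → Fin.toℕ b ≤ Fin.toℕ c)
  first-bag v m a le v∈ with Fin.any? (λ c → (v Sub.∈? bag 𝒯 c) ×-dec (Fin.toℕ c <? Fin.toℕ a))
  ... | no none = a , v∈ , λ c v∈c → ≮⇒≥ (λ lt → none (c , v∈c , lt))
  first-bag v zero a le v∈ | yes (c , v∈c , lt) = contradiction (≤-trans lt le) λ ()
  first-bag v (suc m) a le v∈ | yes (c , v∈c , lt) = first-bag v m c (≤-pred (≤-trans lt le)) v∈c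

  first : ∀ v → ∃ λ b → v Sub.∈ bag 𝒯 b × (∀ c → v Sub.∈ bag 𝒯 c → Fin.toℕ b ≤ Fin.toℕ c)
  first v with vertex-cover 𝒯 v
  ... | a , v∈ = first-bag v _ a ≤-refl v∈

  firstPath : ∀ v → ∃ λ p → IsPath p × tip p ≡ proj₁ (first v)
  firstPath v = pathTo _ (proj₁ (first v)) ≤-refl

  data Below (a : Node t) : Node t → Set where
    itself : Below a a
    child  : ∀ {i} → Below a (parent t i) → Below a (Fin.suc i)

  Below-≤ : ∀ {a b} → Below a b → Fin.toℕ a ≤ Fin.toℕ b
  Below-≤ itself        = ≤-refl
  Below-≤ (child {i} d) = m≤n⇒m≤1+n (≤-trans (Below-≤ d) (parent-≤ t i))

  -- The only tree edge out of the subtree of a node goes to its parent.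
  leave-subtree : ∀ {P : Node t → Set} {i a b k} → Below (Fin.suc i) a →
                  Walk (λ x y → TEdge t x y × P x × P y) a b k →
                  Below (Fin.suc i) b ⊎ P (parent t i)
  leave-subtree d [] = inj₁ d
  leave-subtree d ((inj₂ (_ , refl , refl) , _ , _) ∷ w)  = leave-subtree (child d) w
  leave-subtree itself    ((inj₁ (_ , refl , refl) , _ , pb) ∷ w) = inj₂ pb
  leave-subtree (child d) ((inj₁ (_ , refl , refl) , _ , _) ∷ w)  = leave-subtree d w

  -- Follow the subtree of `v` from `Fin.suc i` to its first node: a walk avoiding the parent ends
  -- below `Fin.suc i`, and minimality of the index forces equality.
  bag-parent : ∀ {v i} → v Sub.∈ bag 𝒯 (Fin.suc i) →
               proj₁ (first v) ≡ Fin.suc i ⊎ v Sub.∈ bag 𝒯 (parent t i)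
  bag-parent {v} {i} v∈ with first v
  ... | a , v∈a , least with connected 𝒯 v (Fin.suc i) a v∈ v∈a
  ...   | _ , w with leave-subtree itself w
  ...     | inj₂ v∈p = inj₂ v∈p
  ...     | inj₁ d   = inj₁ (Fin.toℕ-injective (≤-antisym (least _ v∈) (Below-≤ d)))

  module Content (W : Vertex G → Set) (content : Node t → List (Vertex G))
                 (content⁺ : ∀ {v a} → v Sub.∈ bag 𝒯 a → W v → v ∈ content a)
                 (content⁻ : ∀ {v a} → v ∈ content a → v Sub.∈ bag 𝒯 a × W v) where

    -- Label lists that are not paths from the root get an empty bag.
    pathBag : List Label → List (Vertex G)
    pathBag p = if does (isPath? p) then content (tip p) else []

    pathBag⁺ : ∀ {v p} → IsPath p → v ∈ content (tip p) → v ∈ pathBag p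
    pathBag⁺ {p = p} vp v∈ with isPath? p
    ... | yes _  = v∈
    ... | no ¬vp = contradiction vp ¬vp

    pathBag⁻ : ∀ {v} p → v ∈ pathBag p → IsPath p × v ∈ content (tip p)
    pathBag⁻ p v∈ with isPath? p
    pathBag⁻ p v∈ | yes vp = vp , v∈
    pathBag⁻ p () | no _

    firstPath≡ : ∀ v p → IsPath p → proj₁ (first v) ≡ tip p → proj₁ (firstPath v) ≡ p
    firstPath≡ v p vp eq =
      path-unique _ p (proj₁ (proj₂ (firstPath v))) vp (trans (proj₂ (proj₂ (firstPath v))) eq)

    rootedBags : RootedBags (Vertex G) Label
    rootedBags = record
      { bagAt   = pathBag
      ; top     = λ v → proj₁ (firstPath v)
      ; up-root = at-root
      ; up      = above-root
      }
      where
      at-root : ∀ {v} → v ∈ pathBag [] → proj₁ (firstPath v) ≡ []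
      at-root {v} v∈ = firstPath≡ v [] tt
        (Fin.toℕ-injective (n≤0⇒n≡0 (proj₂ (proj₂ (first v)) Fin.zero (proj₁ (content⁻ v∈)))))
      above-root : ∀ {v i p} → v ∈ pathBag (i ∷ p) → proj₁ (firstPath v) ≡ i ∷ p ⊎ v ∈ pathBag p
      above-root {v} {i} {p} v∈ with pathBag⁻ (i ∷ p) v∈
      ... | (eq , vp) , v∈c with bag-parent (proj₁ (content⁻ v∈c))
      ...   | inj₁ eq' = inj₁ (firstPath≡ v (i ∷ p) (eq , vp) eq')
      ...   | inj₂ v∈p = inj₂ (pathBag⁺ {p = p} vp
                (content⁺ (subst (λ a → v Sub.∈ bag 𝒯 a) (sym eq) v∈p) (proj₂ (content⁻ v∈c))))

    edge-adjoined : ∀ {x y} → Edge G x y → W x → W y → RootedBags.Adjoined rootedBags x y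
    edge-adjoined {x} {y} e wx wy with edge-cover 𝒯 x y e
    ... | a , x∈ , y∈ with pathTo _ a ≤-refl
    ...   | p , vp , refl = RootedBags.common-bag rootedBags p
                              (pathBag⁺ {p = p} vp (content⁺ x∈ wx))
                              (pathBag⁺ {p = p} vp (content⁺ y∈ wy))

    pathBag-length : ∀ {k} → (∀ a → length (content a) ≤ k) → ∀ p → length (pathBag p) ≤ k
    pathBag-length le p with isPath? p
    ... | yes _ = le (tip p)
    ... | no _  = z≤n

-- Auxiliary facts on subsets, lists and differences.

subsetList : ∀ {n} → Sub.Subset n → List (Fin n)
subsetList Vec.[]            = []
subsetList (false Vec.∷ p) = map Fin.suc (subsetList p)
subsetList (true Vec.∷ p)  = Fin.zero ∷ map Fin.suc (subsetList p)

subsetList-length : ∀ {n} (p : Sub.Subset n) → length (subsetList p) ≡ Sub.∣ p ∣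
subsetList-length Vec.[]          = refl
subsetList-length (false Vec.∷ p) =
  trans (List.length-map Fin.suc (subsetList p)) (subsetList-length p)
subsetList-length (true Vec.∷ p)  =
  cong suc (trans (List.length-map Fin.suc (subsetList p)) (subsetList-length p))

∈-subsetList⁺ : ∀ {n} {p : Sub.Subset n} {v} → v Sub.∈ p → v ∈ subsetList p
∈-subsetList⁺ {p = true Vec.∷ _}  Vec.here       = here refl
∈-subsetList⁺ {p = true Vec.∷ _}  (Vec.there v∈) = there (∈-map⁺ Fin.suc (∈-subsetList⁺ v∈))
∈-subsetList⁺ {p = false Vec.∷ _} (Vec.there v∈) = ∈-map⁺ Fin.suc (∈-subsetList⁺ v∈)

∈-subsetList⁻ : ∀ {n} (p : Sub.Subset n) {v} → v ∈ subsetList p → v Sub.∈ p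
∈-subsetList⁻ (true Vec.∷ p)  (here refl) = Vec.here
∈-subsetList⁻ (true Vec.∷ p)  (there v∈) with ∈-map⁻ Fin.suc v∈
... | _ , v∈' , refl = Vec.there (∈-subsetList⁻ p v∈')
∈-subsetList⁻ (false Vec.∷ p) v∈ with ∈-map⁻ Fin.suc v∈
... | _ , v∈' , refl = Vec.there (∈-subsetList⁻ p v∈')

∈-tabulate⁺ : ∀ {n} {f : Fin n → Bool} {v} → f v ≡ true → v Sub.∈ Vec.tabulate f
∈-tabulate⁺ {f = f} {v} eq = Vec.lookup⇒[]= v _ (trans (Vec.lookup∘tabulate f v) eq)

∈-tabulate⁻ : ∀ {n} (f : Fin n → Bool) {v} → v Sub.∈ Vec.tabulate f → f v ≡ true
∈-tabulate⁻ f {v} v∈ = trans (sym (Vec.lookup∘tabulate f v)) (Vec.[]=⇒lookup v∈)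

isYes⁺ : ∀ {P : Set} (d : Dec P) → P → isYes d ≡ true
isYes⁺ d p = trans (isYes≗does d) (dec-true d p)

isYes⁻ : ∀ {P : Set} (d : Dec P) → isYes d ≡ true → P
isYes⁻ (yes p) refl = p

length-concatMap : ∀ {A B : Set} (f : A → List B) {w} → (∀ a → length (f a) ≤ w) →
                   ∀ xs → length (concatMap f xs) ≤ length xs * w
length-concatMap f le []       = z≤n
length-concatMap f le (x ∷ xs) =
  ≤-trans (≤-reflexive (List.length-++ (f x))) (+-mono-≤ (le x) (length-concatMap f le xs))

∸-⊔-≤1 : ∀ a b → (a ∸ b) ⊔ (b ∸ a) ≤ 1 → a ≤ suc b × b ≤ suc a
∸-⊔-≤1 a b le =
  gap a b (≤-trans (m≤m⊔n (a ∸ b) (b ∸ a)) le) , gap b a (≤-trans (m≤n⊔m (a ∸ b) (b ∸ a)) le)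
  where
  gap : ∀ a b → a ∸ b ≤ 1 → a ≤ suc b
  gap a b le = ≤-trans (m≤n+m∸n a b) (≤-trans (+-monoʳ-≤ b le) (≤-reflexive (+-comm b 1)))

-- Windows of consecutive layers.

module Layered {w : ℕ} {G : Graph} (𝒯 : TreeDecomposition G) (layer : Vertex G → ℕ)
               (layering : IsLayering G layer)
               (width : ∀ a ℓ → Sub.∣ bag 𝒯 a Sub.∩ LayerSet G layer ℓ ∣ ≤ w) where
  open TreeNodes 𝒯

  edge-layer : ∀ {x y} → Edge G x y → layer x ≤ suc (layer y) × layer y ≤ suc (layer x)
  edge-layer {x} {y} e = ∸-⊔-≤1 (layer x) (layer y) (layering x y e)

  dist-layer : ∀ {m x y} → Dist (Edge G) m x y → layer x ≤ m + layer y
  dist-layer {m} stop   = m≤n+m _ m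
  dist-layer (step e d) = ≤-trans (proj₁ (edge-layer e)) (s≤s (dist-layer d))

  module Window (lo len : ℕ) where

    In : Vertex G → Set
    In v = lo ≤ layer v × layer v < lo + len

    in? : ∀ v → Dec (In v)
    in? v = (lo ≤? layer v) ×-dec (layer v <? lo + len)

    sliceSet : Node (tree 𝒯) → ℕ → Sub.Subset (n G)
    sliceSet a ℓ = bag 𝒯 a Sub.∩ LayerSet G layer ℓ

    slice : Node (tree 𝒯) → ℕ → List (Vertex G)
    slice a ℓ = subsetList (sliceSet a ℓ)

    content : Node (tree 𝒯) → List (Vertex G)
    content a = concatMap (slice a) (applyUpTo (lo +_) len)

    content⁺ : ∀ {v a} → v Sub.∈ bag 𝒯 a → In v → v ∈ content a
    content⁺ {v} {a} v∈ (l , u) = ∈-concatMap⁺ (slice a) (lose ℓ∈ v∈slice)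
      where
      ℓ∈ : layer v ∈ applyUpTo (lo +_) len
      ℓ∈ = subst (_∈ applyUpTo (lo +_) len) (m+[n∸m]≡n l)
             (∈-applyUpTo⁺ (lo +_) (+-cancelˡ-< lo _ _ (subst (_< lo + len) (sym (m+[n∸m]≡n l)) u)))
      v∈slice : v ∈ slice a (layer v)
      v∈slice = ∈-subsetList⁺ (Sub.x∈p∩q⁺ (v∈ , ∈-tabulate⁺ (isYes⁺ (layer v ≟ layer v) refl)))

    content⁻ : ∀ {v a} → v ∈ content a → v Sub.∈ bag 𝒯 a × In v
    content⁻ {v} {a} v∈ with find (∈-concatMap⁻ (slice a) {xs = applyUpTo (lo +_) len} v∈)
    ... | ℓ , ℓ∈ , v∈slice
      with ∈-applyUpTo⁻ (lo +_) ℓ∈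
         | Sub.x∈p∩q⁻ (bag 𝒯 a) (LayerSet G layer ℓ) (∈-subsetList⁻ (sliceSet a ℓ) v∈slice)
    ... | i , i<len , refl | v∈bag , v∈layer =
      v∈bag , subst (λ ℓ → lo ≤ ℓ × ℓ < lo + len) (sym at-layer) (m≤m+n lo i , +-monoʳ-< lo i<len)
      where
      at-layer : layer v ≡ lo + i
      at-layer = isYes⁻ (layer v ≟ lo + i) (∈-tabulate⁻ (λ u → isYes (layer u ≟ lo + i)) v∈layer)

    open Content In content content⁺ content⁻

    windowGraph : BagGraph (n G) (Fin (size (tree 𝒯)))
    windowGraph = record
      { E      = λ x y → Edge G x y × In x × In y
      ; E?     = λ x y → T? (adj G x y) ×-dec in? x ×-dec in? y
      ; E-sym  = λ { {x} {y} (e , wx , wy) → adj-sym G x y e , wy , wx }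
      ; bags   = rootedBags
      ; E-bags = λ (e , wx , wy) → edge-adjoined e wx wy
      }

    -- Each of the `len` layers contributes at most `w` vertices to a bag.
    window-width : BagGraph.Width≤ windowGraph (len * w)
    window-width = pathBag-length λ a →
      ≤-trans (length-concatMap (slice a) (slice-length a) (applyUpTo (lo +_) len))
              (≤-reflexive (cong (_* w) (List.length-applyUpTo (lo +_) len)))
      where
      slice-length : ∀ a ℓ → length (slice a ℓ) ≤ w
      slice-length a ℓ = ≤-trans (≤-reflexive (subsetList-length (sliceSet a ℓ))) (width a ℓ)

  stripBound : ℕ → ℕ → ℕ
  stripBound s R = twBound ((R + (s + R)) * w) R

  -- The strip [lo, lo + s) is padded by R on both sides, so that walks of
  -- length at most R between its vertices stay in the window.
  abstract
    strip-colouring : ∀ lo s R → Σ (Vertex G → Bool) λ col → ∀ {b x y} →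
      Chain (λ v → (lo ≤ layer v × layer v < lo + s) × col v ≡ b) (Dist (Edge G) R) x y →
      Dist (Edge G) (stripBound s R) x y
    strip-colouring lo s R
      with bounded-treewidth-colouring ((R + (s + R)) * w) R Fin._≟_
             (Window.windowGraph (lo ∸ R) (R + (s + R)))
             (Window.window-width (lo ∸ R) (R + (s + R)))
    ... | col , bound = col , λ c →
      forget (bound (Chain-map id proj₂ (λ (inx , _) _ d → confine inx ≤-refl d) c))
      where
      open Window (lo ∸ R) (R + (s + R)) using (In)
      EW : Vertex G → Vertex G → Set
      EW x y = Edge G x y × In x × In y

      forget : ∀ {m x y} → Dist EW m x y → Dist (Edge G) m x y
      forget stop             = stop
      forget (step (e , _) d) = step e (forget d)

      -- Describes a vertex reached after `p` steps from the strip.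
      Slack : ℕ → Vertex G → Set
      Slack p v = lo ≤ p + layer v × layer v < p + (lo + s)

      slack-in : ∀ {p v} → p ≤ R → Slack p v → In v
      slack-in {p} {v} le (l , u) =
        m≤n+o⇒m∸n≤o lo R (≤-trans l (+-monoˡ-≤ (layer v) le)) , ≤-trans u (begin
          -- If `lo ∸ R` is cut off at 0, the upper end of the window only moves up.
          p + (lo + s)               ≤⟨ +-mono-≤ le (+-monoˡ-≤ s (m≤n+m∸n lo R)) ⟩
          R + ((R + (lo ∸ R)) + s)   ≡⟨ rearrange R s (lo ∸ R) ⟩
          (lo ∸ R) + (R + (s + R))   ∎)
        where
        open ≤-Reasoning
        rearrange : ∀ R s a → R + ((R + a) + s) ≡ a + (R + (s + R))
        rearrange = solve-∀

      confine : ∀ {m p x y} → Slack p x → p + m ≤ R → Dist (Edge G) m x y → Dist EW m x y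
      confine sl le stop = stop
      confine {suc m} {p} {x} (l , u) le (step {y = z} e d) =
        step (e , slack-in (≤-trans (m≤m+n p (suc m)) le) (l , u) ,
                  slack-in (≤-trans (s≤s (m≤m+n p m)) le') slz)
             (confine slz le' d)
        where
        le' : suc p + m ≤ R
        le' = ≤-trans (≤-reflexive (sym (+-suc p m))) le
        slz : Slack (suc p) z
        slz = ≤-trans l (≤-trans (+-monoʳ-≤ p (proj₁ (edge-layer e)))
                                 (≤-reflexive (+-suc p (layer z))))
            , s≤s (≤-trans (proj₂ (edge-layer e)) u)

-- The cyclic pattern of strips.

data Kind : Set where
  blockA zone blockB : Kind

kind : ℕ → Kind
kind 0 = blockA
kind 1 = zone
kind 2 = blockB
kind 3 = zone
kind (suc (suc (suc (suc j)))) = kind j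

Adjacent : ℕ → ℕ → Set
Adjacent i j = i ≤ suc j × j ≤ suc i

adjacent-elim : ∀ (P : ℕ → ℕ → Set) → (∀ i → P i i) → (∀ {i j} → P i j → P j i) →
                (∀ i → P i (suc i)) →
                ∀ {i j} → Adjacent i j → P i j
adjacent-elim P rfl sy nxt {i} {j} (a , b) with <-cmp i j
... | tri≈ _ refl _ = rfl i
... | tri< i<j _ _  = subst (P i) (≤-antisym i<j b) (nxt i)
... | tri> _ _ j<i  = sy (subst (P j) (≤-antisym j<i a) (nxt j))

zone-adjacent : ∀ {i j} → Adjacent i j → kind i ≡ zone → kind j ≡ zone → i ≡ j
zone-adjacent = adjacent-elim (λ i j → kind i ≡ zone → kind j ≡ zone → i ≡ j)
  (λ _ _ _ → refl) (λ f p q → sym (f q p)) (λ i p q → ⊥-elim (next i p q))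
  where
  next : ∀ i → kind i ≡ zone → ¬ (kind (suc i) ≡ zone)
  next 0 () _
  next 1 _ ()
  next 2 () _
  next 3 _ ()
  next (suc (suc (suc (suc i)))) = next i

block-adjacent : ∀ {i j} → Adjacent i j → kind i ≢ zone → kind j ≢ zone → i ≡ j
block-adjacent = adjacent-elim (λ i j → kind i ≢ zone → kind j ≢ zone → i ≡ j)
  (λ _ _ _ → refl) (λ f p q → sym (f q p)) (λ i p q → ⊥-elim (next i p q))
  where
  next : ∀ i → kind i ≢ zone → ¬ (kind (suc i) ≢ zone)
  next 0 _ q = q refl
  next 1 p _ = p refl
  next 2 _ q = q refl
  next 3 p _ = p refl
  next (suc (suc (suc (suc i)))) = next i

-- Each block of one kind is grouped with the two zones next to it; the value
-- at a block of the other kind is junk.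
groupA groupB : ℕ → ℕ
groupA 3 = 1
groupA (suc (suc (suc (suc j)))) = suc (groupA j)
groupA _ = 0
groupB (suc (suc (suc (suc j)))) = suc (groupB j)
groupB _ = 0

-- Removing the blocks B splits the strips into runs around one block A each, and `groupA` numbers
-- these runs.
groupA-adjacent : ∀ {i j} → Adjacent i j → kind i ≢ blockB → kind j ≢ blockB → groupA i ≡ groupA j
groupA-adjacent = adjacent-elim (λ i j → kind i ≢ blockB → kind j ≢ blockB → groupA i ≡ groupA j)
  (λ _ _ _ → refl) (λ f p q → sym (f q p)) next
  where
  next : ∀ i → kind i ≢ blockB → kind (suc i) ≢ blockB → groupA i ≡ groupA (suc i)
  next 0 _ _ = refl
  next 1 _ q = contradiction refl q
  next 2 p _ = contradiction refl p
  next 3 _ _ = refl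
  next (suc (suc (suc (suc i)))) p q = cong suc (next i p q)

groupB-adjacent : ∀ {i j} → Adjacent i j → kind i ≢ blockA → kind j ≢ blockA → groupB i ≡ groupB j
groupB-adjacent = adjacent-elim (λ i j → kind i ≢ blockA → kind j ≢ blockA → groupB i ≡ groupB j)
  (λ _ _ _ → refl) (λ f p q → sym (f q p)) next
  where
  next : ∀ i → kind i ≢ blockA → kind (suc i) ≢ blockA → groupB i ≡ groupB (suc i)
  next 0 p _ = contradiction refl p
  next 1 _ _ = refl
  next 2 _ _ = refl
  next 3 _ q = contradiction refl q
  next (suc (suc (suc (suc i)))) p q = cong suc (next i p q)

groupA-block : ∀ i j → kind i ≡ blockA → kind j ≡ blockA → groupA i ≡ groupA j → i ≡ j
groupA-block i j p q eq = trans (retract i p) (trans (cong (_* 4) eq) (sym (retract j q)))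
  where
  retract : ∀ i → kind i ≡ blockA → i ≡ groupA i * 4
  retract 0 _ = refl
  retract (suc (suc (suc (suc i)))) p = cong (4 +_) (retract i p)

groupB-block : ∀ i j → kind i ≡ blockB → kind j ≡ blockB → groupB i ≡ groupB j → i ≡ j
groupB-block i j p q eq =
  trans (retract i p) (trans (cong (λ g → 2 + g * 4) eq) (sym (retract j q)))
  where
  retract : ∀ i → kind i ≡ blockB → i ≡ 2 + groupB i * 4
  retract 2 _ = refl
  retract (suc (suc (suc (suc i)))) p = cong (4 +_) (retract i p)

-- Three colours for layered tree-width.

pattern 0F = Fin.zero
pattern 1F = Fin.suc Fin.zero
pattern 2F = Fin.suc (Fin.suc Fin.zero)

-- The first and third are `stripBound (suc r)` at scales `r` and `blockScale w r`, written out to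
-- depend on `w` and `r` alone, as a control function must. A step at `blockScale` crosses a whole
-- zone run.
zoneBound blockScale blockBound asdimBound : ℕ → ℕ → ℕ
zoneBound w r  = twBound ((r + (suc r + r)) * w) r
blockScale w r = r + (zoneBound w r + r)
blockBound w r = twBound ((blockScale w r + (suc r + blockScale w r)) * w) (blockScale w r)
asdimBound w r = (zoneBound w r + r) + (blockBound w r + (r + zoneBound w r))

module ThreeColours {w : ℕ} {G : Graph} (𝒯 : TreeDecomposition G) (layer : Vertex G → ℕ)
                    (layering : IsLayering G layer)
                    (width : ∀ a ℓ → Sub.∣ bag 𝒯 a Sub.∩ LayerSet G layer ℓ ∣ ≤ w) (r : ℕ) where
  open Layered 𝒯 layer layering width

  private
    s : ℕ
    -- A step of length `r` then reaches at most a neighbouring strip, and the divisor is nonzero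
    -- even for `r = 0`.
    s = suc r

  strip : Vertex G → ℕ
  strip v = layer v / s

  strip-range : ∀ v → strip v * s ≤ layer v × layer v < strip v * s + s
  strip-range v = m/n*n≤m (layer v) s , (begin-strict
    layer v                        ≡⟨ m≡m%n+[m/n]*n (layer v) s ⟩
    layer v % s + strip v * s      <⟨ +-monoˡ-< (strip v * s) (m%n<n (layer v) s) ⟩
    s + strip v * s                ≡⟨ +-comm s _ ⟩
    strip v * s + s                ∎)
    where open ≤-Reasoning

  strip-adjacent : ∀ {x y} → Dist (Edge G) r x y → Adjacent (strip x) (strip y)
  strip-adjacent d = le d , le (Dist-sym (λ {x} {y} → adj-sym G x y) d)
    where
    le : ∀ {x y} → Dist (Edge G) r x y → strip x ≤ suc (strip y)
    le {x} {y} d = begin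
      layer x / s         ≤⟨ /-monoˡ-≤ s (m≤n⇒m≤1+n (dist-layer d)) ⟩
      (s + layer y) / s   ≡⟨ m/n≡1+[m∸n]/n (m≤m+n s (layer y)) ⟩
      suc ((s + layer y ∸ s) / s)   ≡⟨ cong (λ ℓ → suc (ℓ / s)) (m+n∸m≡n s (layer y)) ⟩
      suc (layer y / s)   ∎
      where open ≤-Reasoning

  stripColour : ℕ → ℕ → Vertex G → Bool
  stripColour R j = proj₁ (strip-colouring (j * s) s R)

  strip-bound : ∀ {R j b x y} →
                Chain (λ v → strip v ≡ j × stripColour R j v ≡ b) (Dist (Edge G) R) x y →
                Dist (Edge G) (stripBound s R) x y
  strip-bound {R} {j} {b} c = proj₂ (strip-colouring (j * s) s R) {b}
    (Chain-map id (λ { {v} (refl , eq) → strip-range v , eq }) (λ _ _ d → d) c)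

  scale : Kind → ℕ
  scale zone = r
  scale _    = blockScale w r

  paint : Kind → Bool → Fin 3
  paint blockA true  = 0F
  paint blockA false = 1F
  paint blockB true  = 0F
  paint blockB false = 2F
  paint zone   true  = 1F
  paint zone   false = 2F

  bit : Vertex G → Bool
  bit v = stripColour (scale (kind (strip v))) (strip v) v

  colour₃ : Vertex G → Fin 3
  colour₃ v = paint (kind (strip v)) (bit v)

  zone? : ∀ v → Dec (kind (strip v) ≡ zone)
  zone? v with kind (strip v)
  ... | blockA = no λ ()
  ... | zone   = yes refl
  ... | blockB = no λ ()

  -- A chain alternates between the block (of kind κ) of its group and the two
  -- neighbouring zones. Its pieces in the zones have bounded length, and the
  -- colouring of the block was chosen at a scale that bridges them.
  module Mixed (κ : Kind) (κ≢zone : κ ≢ zone) (scale-κ : scale κ ≡ blockScale w r)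
               (group : ℕ → ℕ) (b b' : Bool) (M : Vertex G → Set)
               (cases : ∀ {v} → M v → (kind (strip v) ≡ κ × bit v ≡ b)
                                    ⊎ (kind (strip v) ≡ zone × bit v ≡ b'))
               (group-adjacent : ∀ {x y} → M x → M y → Adjacent (strip x) (strip y) →
                                 group (strip x) ≡ group (strip y))
               (group-block : ∀ i j → kind i ≡ κ → kind j ≡ κ → group i ≡ group j → i ≡ j)
               where

    zone-bound : ∀ {x y} → Chain (λ v → M v × kind (strip v) ≡ zone) (Dist (Edge G) r) x y →
                 Dist (Edge G) (zoneBound w r) x y
    zone-bound c = strip-bound (Chain-map id in-strip (λ _ _ d → d)
      (Chain-const strip (λ (_ , zx) (_ , zy) d → zone-adjacent (strip-adjacent d) zx zy) refl c))
      where
      in-strip : ∀ {v j} → (M v × kind (strip v) ≡ zone) × strip v ≡ j →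
                 strip v ≡ j × stripColour r j v ≡ b'
      in-strip {v} ((m , z) , refl) with cases m
      ... | inj₁ (k , _) = contradiction (trans (sym k) z) κ≢zone
      ... | inj₂ (_ , e) = refl , subst (λ k → stripColour (scale k) (strip v) v ≡ b') z e

    -- Jumps across zones can be longer than a strip is wide, so adjacency of strips says nothing
    -- here; instead the fixed group `g` contains only one block of kind `κ`.
    block-bound : ∀ {g x y} →
                  Chain (λ v → (M v × group (strip v) ≡ g) × ¬ (kind (strip v) ≡ zone))
                        (Dist (Edge G) (blockScale w r)) x y →
                  Dist (Edge G) (blockBound w r) x y
    block-bound {g} c = strip-bound (Chain-map id in-strip (λ _ _ d → d)
      (Chain-const strip (λ { ((mx , gx) , nx) ((my , gy) , ny) _ →
                              group-block _ _ (is-κ mx nx) (is-κ my ny) (trans gx (sym gy)) })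
        refl c))
      where
      is-κ : ∀ {v} → M v → ¬ (kind (strip v) ≡ zone) → kind (strip v) ≡ κ
      is-κ m nz with cases m
      ... | inj₁ (k , _) = k
      ... | inj₂ (z , _) = contradiction z nz
      in-strip : ∀ {v j} → ((M v × group (strip v) ≡ g) × ¬ (kind (strip v) ≡ zone)) × strip v ≡ j →
                 strip v ≡ j × stripColour (blockScale w r) j v ≡ b
      in-strip {v} (((m , _) , nz) , refl) with cases m
      ... | inj₁ (k , e) =
        refl , subst (λ R → stripColour R (strip v) v ≡ b) (trans (cong scale k) scale-κ) e
      ... | inj₂ (z , _) = contradiction z nz

    mixed-bound : ∀ {x y} → Chain M (Dist (Edge G) r) x y → Dist (Edge G) (asdimBound w r) x y
    mixed-bound c =
      excursion-bound (λ {x} {y} → adj-sym G x y) zone? r _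
        (λ c' → zone-bound (Chain-map id (λ ((m , _) , z) → m , z) (λ _ _ d → d) c'))
        block-bound
        (Chain-const (group ∘ strip) (λ mx my d → group-adjacent mx my (strip-adjacent d)) refl c)

  -- Handles colour 0. A zone separates any two blocks, so the chain stays in one, whose colouring
  -- is valid at the larger scale `blockScale w r`.
  block-only-bound : ∀ {M : Vertex G → Set} →
                     (∀ {v} → M v → kind (strip v) ≢ zone × bit v ≡ true) →
                     ∀ {x y} → Chain M (Dist (Edge G) r) x y → Dist (Edge G) (asdimBound w r) x y
  block-only-bound {M} block c = Dist-mono
    (≤-trans (m≤m+n (blockBound w r) _) (m≤n+m _ (zoneBound w r + r)))
    (strip-bound (Chain-map id in-strip (λ _ _ → Dist-mono (m≤m+n r _))
      (Chain-const strip
        (λ mx my d → block-adjacent (strip-adjacent d) (proj₁ (block mx)) (proj₁ (block my)))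
        refl c)))
    where
    block-scale : ∀ {k} → k ≢ zone → scale k ≡ blockScale w r
    block-scale {blockA} _  = refl
    block-scale {zone}   nz = contradiction refl nz
    block-scale {blockB} _  = refl
    in-strip : ∀ {v j} → M v × strip v ≡ j → strip v ≡ j × stripColour (blockScale w r) j v ≡ true
    in-strip {v} (m , refl) with block m
    ... | nz , e = refl , subst (λ R → stripColour R (strip v) v ≡ true) (block-scale nz) e

  paint-0 : ∀ k b → paint k b ≡ 0F → k ≢ zone × b ≡ true
  paint-0 blockA true refl = (λ ()) , refl
  paint-0 blockB true refl = (λ ()) , refl
  paint-0 zone true  ()
  paint-0 zone false ()

  paint-1 : ∀ k b → paint k b ≡ 1F → (k ≡ blockA × b ≡ false) ⊎ (k ≡ zone × b ≡ true)
  paint-1 blockA false refl = inj₁ (refl , refl)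
  paint-1 zone   true  refl = inj₂ (refl , refl)
  paint-1 blockB true  ()
  paint-1 blockB false ()

  paint-2 : ∀ k b → paint k b ≡ 2F → (k ≡ blockB × b ≡ false) ⊎ (k ≡ zone × b ≡ false)
  paint-2 blockB false refl = inj₁ (refl , refl)
  paint-2 zone   false refl = inj₂ (refl , refl)
  paint-2 blockA true  ()
  paint-2 blockA false ()

  colour₃-bound : ∀ i {x y} → Chain (λ v → colour₃ v ≡ i) (Dist (Edge G) r) x y →
                  Dist (Edge G) (asdimBound w r) x y
  colour₃-bound 0F = block-only-bound (λ {v} → paint-0 (kind (strip v)) (bit v))
  colour₃-bound 1F =
    Mixed.mixed-bound blockA (λ ()) refl groupA false true (λ v → colour₃ v ≡ 1F)
      (λ {v} → paint-1 (kind (strip v)) (bit v))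
      (λ {x} {y} mx my a → groupA-adjacent a (not-B x mx) (not-B y my))
      groupA-block
    where
    not-B : ∀ v → colour₃ v ≡ 1F → kind (strip v) ≢ blockB
    not-B v m k with paint-1 (kind (strip v)) (bit v) m
    ... | inj₁ (k' , _) with trans (sym k) k'
    ...   | ()
    not-B v m k | inj₂ (k' , _) with trans (sym k) k'
    ...   | ()
  colour₃-bound 2F =
    Mixed.mixed-bound blockB (λ ()) refl groupB false false (λ v → colour₃ v ≡ 2F)
      (λ {v} → paint-2 (kind (strip v)) (bit v))
      (λ {x} {y} mx my a → groupB-adjacent a (not-A x mx) (not-A y my))
      groupB-block
    where
    not-A : ∀ v → colour₃ v ≡ 2F → kind (strip v) ≢ blockA
    not-A v m k with paint-2 (kind (strip v)) (bit v) m
    ... | inj₁ (k' , _) with trans (sym k) k'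
    ...   | ()
    not-A v m k | inj₂ (k' , _) with trans (sym k) k'
    ...   | ()

-- From colourings to covers.

component-labels : ∀ {n} {R : Fin n → Fin n → Set} → (∀ x y → Dec (R x y)) →
                   Σ (Fin n → Fin n) λ label →
                     (∀ {x y} → R x y → label x ≡ label y) ×
                     (∀ {x y} → label x ≡ label y → EqClosure R x y)
component-labels {n} {R} R? with merge-all (cartesianProduct (allFin n) (allFin n))
  where
  -- Union-find over the list of pairs: each related pair `a`, `b` gives the class of `b` the label
  -- of `a`.
  merge-all : ∀ ps → Σ (Fin n → Fin n) λ label →
                (∀ {x y} → (x , y) ∈ ps → R x y → label x ≡ label y) ×
                (∀ {x y} → label x ≡ label y → EqClosure R x y)
  merge-all [] = id , (λ ()) , λ { refl → ε }
  merge-all ((a , b) ∷ ps) with merge-all ps | R? a b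
  ... | label , resp , conn | no ¬r =
    label , (λ { (here refl) r → contradiction r ¬r ; (there m) r → resp m r }) , conn
  ... | label , resp , conn | yes r = relabel ∘ label , resp' , conn'
    where
    relabel : Fin n → Fin n
    relabel l = if does (l Fin.≟ label b) then label a else l
    relabel-a : relabel (label a) ≡ label a
    relabel-a with label a Fin.≟ label b
    ... | yes _ = refl
    ... | no _  = refl
    relabel-b : relabel (label b) ≡ label a
    relabel-b with label b Fin.≟ label b
    ... | yes _ = refl
    ... | no ¬e = contradiction refl ¬e
    resp' : ∀ {x y} → (x , y) ∈ ((a , b) ∷ ps) → R x y → relabel (label x) ≡ relabel (label y)
    resp' (here refl) _ = trans relabel-a (sym relabel-b)
    resp' (there m) r'  = cong relabel (resp m r')
    a~b : EqClosure R a b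
    a~b = return r
    conn' : ∀ {x y} → relabel (label x) ≡ relabel (label y) → EqClosure R x y
    conn' {x} {y} eq with label x Fin.≟ label b | label y Fin.≟ label b
    ... | yes ex | yes ey = conn (trans ex (sym ey))
    ... | yes ex | no _   = conn ex ◅◅ Eq.symmetric R a~b ◅◅ conn eq
    ... | no _   | yes ey = conn eq ◅◅ a~b ◅◅ conn (sym ey)
    ... | no _   | no _   = conn eq
... | label , resp , conn =
  label , (λ {x} {y} → resp (∈-cartesianProduct⁺ (∈-allFin x) (∈-allFin y))) , conn

module _ (G : Graph) where

  Dist⇒Dist≤ : ∀ {m x y} → Dist (Edge G) m x y → Dist≤ G x y m
  Dist⇒Dist≤ stop = 0 , z≤n , []
  Dist⇒Dist≤ (step e d) with Dist⇒Dist≤ d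
  ... | k , le , walk = suc k , s≤s le , e ∷ walk

  Dist≤⇒Dist : ∀ {m x y} → Dist≤ G x y m → Dist (Edge G) m x y
  Dist≤⇒Dist (k , le , walk) = Dist-mono le (go walk)
    where
    go : ∀ {x y k} → Walk (Edge G) x y k → Dist (Edge G) k x y
    go []      = stop
    go (e ∷ w) = step e (go w)

  -- Family `i` consists of the components of colour class `i` at scale `r`, so two points of one
  -- component are joined by a monochromatic chain. Labels that do not occur in the class give empty
  -- sets.
  colouring⇒cover : ∀ {d r D} (col : Vertex G → Fin (suc d)) →
    (∀ i {x y} → Chain (λ v → col v ≡ i) (Dist (Edge G) r) x y → Dist (Edge G) D x y) →
    Σ (CoverFamily G d) λ 𝒰 → GoodCover G d 𝒰 r D
  colouring⇒cover {d} {r} {D} col bound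
    with component-labels {R = λ x y → col x ≡ col y × Dist (Edge G) r x y}
           (λ x y → (col x Fin.≟ col y) ×-dec Dist? (λ u v → T? (adj G u v)) r x y)
  ... | label , resp , conn = 𝒰 , covers , disjoint , bounded
    where
    member : ∀ i j v → Dec (col v ≡ i × label v ≡ j)
    member i j v = (col v Fin.≟ i) ×-dec (label v Fin.≟ j)
    𝒰 : CoverFamily G d
    𝒰 = record { m = λ _ → n G ; U = λ i j → Vec.tabulate (λ v → isYes (member i j v)) }
    U⁻ : ∀ i j v → v Sub.∈ U 𝒰 i j → col v ≡ i × label v ≡ j
    U⁻ i j v v∈ = isYes⁻ (member i j v) (∈-tabulate⁻ (λ v → isYes (member i j v)) v∈)

    covers : ∀ v → ∃[ i ] ∃[ j ] (v Sub.∈ U 𝒰 i j)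
    covers v = col v , label v , ∈-tabulate⁺ (isYes⁺ (member (col v) (label v) v) (refl , refl))

    disjoint : ∀ i j k x x' → j ≢ k → x Sub.∈ U 𝒰 i j → x' Sub.∈ U 𝒰 i k → ¬ Dist≤ G x x' r
    disjoint i j k x x' j≢k x∈ x'∈ d with U⁻ i j x x∈ | U⁻ i k x' x'∈
    ... | refl , refl | eq , refl = j≢k (resp (sym eq , Dist≤⇒Dist d))

    chain : ∀ {i x y} → col x ≡ i → EqClosure (λ x y → col x ≡ col y × Dist (Edge G) r x y) x y →
            Chain (λ v → col v ≡ i) (Dist (Edge G) r) x y
    chain cx ε = end cx
    chain cx (fwd (eq , d) ◅ c) = link cx d (chain (trans (sym eq) cx) c)
    chain cx (bwd (eq , d) ◅ c) =
      link cx (Dist-sym (λ {x} {y} → adj-sym G x y) d) (chain (trans eq cx) c)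

    bounded : ∀ i j x x' → x Sub.∈ U 𝒰 i j → x' Sub.∈ U 𝒰 i j → Dist≤ G x x' D
    bounded i j x x' x∈ x'∈ with U⁻ i j x x∈ | U⁻ i j x' x'∈
    ... | cx , lx | _ , lx' = Dist⇒Dist≤ (bound i (chain cx (conn (trans lx (sym lx')))))

theorem6p3 : (w : ℕ) → 1 ≤ w → AsdimAtMost (LayeredTreeWidthAtMost w) 2
theorem6p3 w _ = asdimBound w , λ G (𝒯 , layer , layering , width) r →
  colouring⇒cover G (ThreeColours.colour₃ 𝒯 layer layering width r)
    (ThreeColours.colour₃-bound 𝒯 layer layering width r)
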